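{- For all positive integers $a,b$, the Aztec rectangle $\mathcal{AR}_{a,b}$ (with no defects) has no 180-cover.
   Context: A cell is a unit square $[i,i+1]\times[j,j+1]$ with $i,j\in\mathbb{Z}$, labelled $(i,j)$. The right-oriented trominoes are the translates of $\{(0,0),(1,0),(1,1)\}$ and of $\{(0,0),(0,1),(1,1)\}$; the left-oriented trominoes are the translates of $\{(0,1),(1,0),(1,1)\}$ and of $\{(0,0),(0,1),(1,0)\}$. A 180-cover of a region $R$ is a partition of $R$ into trominoes which are either all right-oriented or all left-oriented. For positive integers $a,b$, the Aztec rectangle $\mathcal{AR}_{a,b}$ is (up to translation) the region consisting of the cells $(i,j)\in\mathbb{Z}^2$ with $0\le i+j\le 2b$ and $1\le j-i\le 2a+1$. -}

module Defs where

open import Data.Integer using (ℤ; +_; _+_; _-_; _≤_)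
import Data.Nat as ℕ
open ℕ using (ℕ)
open import Data.List using (List; []; _∷_; map)
import Data.List.Membership.Propositional as List
open import Data.Product using (_×_; _,_; ∃-syntax)
open import Data.Sum using (_⊎_)
open import Level using (0ℓ)
open import Relation.Binary.PropositionalEquality using (_≡_)
open import Relation.Unary using (Pred; _∈_; _⊆_)

-- (i , j) stands for the unit square [i,i+1] × [j,j+1].
Cell : Set
Cell = ℤ × ℤ

Region : Set₁
Region = Pred Cell 0ℓ

translate : Cell → Cell → Cell
translate (x , y) (i , j) = (x + i , y + j)

data Orientation : Set where
  right left : Orientation

-- The names say which cell of the 2 × 2 square {0,1} × {0,1} is absent.
data Shape : Set where
  no01 no10 no00 no11 : Shape

shapeCells : Shape → List Cell
shapeCells no01 = (+ 0 , + 0) ∷ (+ 1 , + 0) ∷ (+ 1 , + 1) ∷ []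
shapeCells no10 = (+ 0 , + 0) ∷ (+ 0 , + 1) ∷ (+ 1 , + 1) ∷ []
shapeCells no00 = (+ 0 , + 1) ∷ (+ 1 , + 0) ∷ (+ 1 , + 1) ∷ []
shapeCells no11 = (+ 0 , + 0) ∷ (+ 0 , + 1) ∷ (+ 1 , + 0) ∷ []

shapeOrientation : Shape → Orientation
shapeOrientation no01 = right
shapeOrientation no10 = right
shapeOrientation no00 = left
shapeOrientation no11 = left

-- Distinct pairs (shape, offset) have distinct cell sets, so equality of
-- trominoes as data agrees with equality as sets of cells.
record Tromino : Set where
  constructor tromino
  field
    shape  : Shape
    offset : Cell

  cells : List Cell
  cells = map (translate offset) (shapeCells shape)

  orientation : Orientation
  orientation = shapeOrientation shape

⟦_⟧ : Tromino → Region
⟦ t ⟧ c = c List.∈ Tromino.cells t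

Oriented : Orientation → Pred Tromino 0ℓ
Oriented o t = Tromino.orientation t ≡ o

record IsPartition (R : Region) (T : Pred Tromino 0ℓ) : Set where
  field
    inside   : ∀ {t} → t ∈ T → ⟦ t ⟧ ⊆ R
    covering : ∀ {c} → c ∈ R → ∃[ t ] t ∈ T × c ∈ ⟦ t ⟧
    disjoint : ∀ {t u c} → t ∈ T → u ∈ T → c ∈ ⟦ t ⟧ → c ∈ ⟦ u ⟧ → t ≡ u

record 180-Cover (R : Region) : Set₁ where
  field
    tiles       : Pred Tromino 0ℓ
    isPartition : IsPartition R tiles
    oriented    : tiles ⊆ Oriented right ⊎ tiles ⊆ Oriented left

AztecRectangle : ℕ → ℕ → Region
AztecRectangle a b (i , j) =
  (+ 0 ≤ i + j × i + j ≤ + (2 ℕ.* b)) ×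
  (+ 1 ≤ j - i × j - i ≤ + (2 ℕ.* a ℕ.+ 1))

{-# OPTIONS --safe #-}

-- Write s = i + j and d = j - i, and suppose all tiles are right-oriented, so
-- that each tile contains its offset p and p + (1,1).  A cell with s = 0 can
-- only be the offset cell of its tile, so the cells with s = 2 are all taken by
-- tiles starting on s = 0, and hence every cell with s = 1 is the middle cell of
-- such a tile.  Going through the line s = 1 by increasing d, each of its cells
-- is forced to belong to the tile starting at its neighbour with larger d; the
-- last cell, d = 2a + 1, has no such neighbour.  The reflection i ↦ -1 - i
-- exchanges s with d - 1, the two orientations, and a with b.

module Submission where

open import Data.Integer
  using (ℤ; +_; -[1+_]; _+_; _-_; _≤_; +≤+; -≤+)
open import Data.Integer.Properties
  using (≤-reflexive; +-mono-≤; i≤j⇒0≤j-i; 0≤i-j⇒j≤i)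
open import Data.Integer.Tactic.RingSolver using (solve-∀)
open import Data.List.Relation.Unary.Any using (here; there)
import Data.Nat as ℕ
open import Data.Nat using (ℕ; zero; suc; NonZero)
import Data.Nat.Properties as ℕ
open import Data.Product using (_×_; _,_; proj₁; proj₂; ∃-syntax)
open import Data.Sum using (_⊎_; inj₁; inj₂)
open import Relation.Binary.PropositionalEquality
  using (_≡_; refl; sym; trans; cong; cong₂; subst)
open import Relation.Nullary using (¬_; contradiction)
open import Relation.Unary using (Pred; _∈_; _⊆_)
open import Level using (0ℓ)
open import Defs

-- Integer inequalities

-- Reduces each linear inequality below to a ring identity, which the solver proves.
≤-by-difference : ∀ {p q r s} → q - p ≡ s - r → p ≤ q → r ≤ s
≤-by-difference {p} {q} {r} {s} e p≤q =
  0≤i-j⇒j≤i (subst (+ 0 ≤_) e (i≤j⇒0≤j-i p≤q))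

1≰0 : ¬ (+ 1 ≤ + 0)
1≰0 (+≤+ ())

-- The reflection exchanging the two orientations

reflectCell : Cell → Cell
reflectCell (i , j) = (-[1+ 0 ] - i , j)

reflectShape : Shape → Shape
reflectShape no01 = no11
reflectShape no10 = no00
reflectShape no00 = no10
reflectShape no11 = no01

-- Negating the first coordinate of the plane sends the columns `x` and `x + 1` of the bounding
-- square to `-1 - x` and `-2 - x`. The smaller one, `-2 - x`, is the new offset.
reflectTromino : Tromino → Tromino
reflectTromino (tromino S (x , y)) =
  tromino (reflectShape S) (-[1+ 1 ] - x , y)

reflectCell-involutive : ∀ c → reflectCell (reflectCell c) ≡ c
reflectCell-involutive (i , j) = cong (_, j) (lemma i)
  where
  lemma : ∀ i → -[1+ 0 ] - (-[1+ 0 ] - i) ≡ i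
  lemma = solve-∀

reflectShape-involutive : ∀ S → reflectShape (reflectShape S) ≡ S
reflectShape-involutive no01 = refl
reflectShape-involutive no10 = refl
reflectShape-involutive no00 = refl
reflectShape-involutive no11 = refl

reflectTromino-involutive : ∀ t → reflectTromino (reflectTromino t) ≡ t
reflectTromino-involutive (tromino S (x , y)) =
  cong₂ (λ S′ x′ → tromino S′ (x′ , y)) (reflectShape-involutive S) (lemma x)
  where
  lemma : ∀ x → -[1+ 1 ] - (-[1+ 1 ] - x) ≡ x
  lemma = solve-∀

reflectTromino-right : ∀ t → reflectTromino t ∈ Oriented left → t ∈ Oriented right
reflectTromino-right (tromino no01 _) _ = refl
reflectTromino-right (tromino no10 _) _ = refl
reflectTromino-right (tromino no00 _) ()
reflectTromino-right (tromino no11 _) ()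

reflect-∈ : ∀ t {c} → c ∈ ⟦ t ⟧ → reflectCell c ∈ ⟦ reflectTromino t ⟧
reflect-∈ (tromino S (x , y)) = go S
  where
  0↦1 : ∀ x → -[1+ 0 ] - (x + + 0) ≡ (-[1+ 1 ] - x) + + 1
  0↦1 = solve-∀

  1↦0 : ∀ x → -[1+ 0 ] - (x + + 1) ≡ (-[1+ 1 ] - x) + + 0
  1↦0 = solve-∀

  e0 : ∀ {k} → (-[1+ 0 ] - (x + + 0) , k) ≡ ((-[1+ 1 ] - x) + + 1 , k)
  e0 = cong (_, _) (0↦1 x)

  e1 : ∀ {k} → (-[1+ 0 ] - (x + + 1) , k) ≡ ((-[1+ 1 ] - x) + + 0 , k)
  e1 = cong (_, _) (1↦0 x)

  go : ∀ S {c} → c ∈ ⟦ tromino S (x , y) ⟧ →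
       reflectCell c ∈ ⟦ reflectTromino (tromino S (x , y)) ⟧
  go no01 (here refl)                 = there (there (here e0))
  go no01 (there (here refl))         = here e1
  go no01 (there (there (here refl))) = there (here e1)
  go no10 (here refl)                 = there (here e0)
  go no10 (there (here refl))         = there (there (here e0))
  go no10 (there (there (here refl))) = here e1
  go no00 (here refl)                 = there (there (here e0))
  go no00 (there (here refl))         = here e1
  go no00 (there (there (here refl))) = there (here e1)
  go no11 (here refl)                 = there (here e0)
  go no11 (there (here refl))         = there (there (here e0))
  go no11 (there (there (here refl))) = here e1

reflect-Aztec : ∀ a b c → c ∈ AztecRectangle b a → reflectCell c ∈ AztecRectangle a b
reflect-Aztec a b (i , j) ((0≤s , s≤2a) , (1≤d , d≤2b+1)) =
  (≤-by-difference (e₁ i j) 1≤d , ≤-by-difference (e₂ i j (+ (2 ℕ.* b))) d≤2b+1) ,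
  (≤-by-difference (e₃ i j) 0≤s , ≤-by-difference (e₄ i j (+ (2 ℕ.* a))) s≤2a)
  where
  e₁ : ∀ i j → (j - i) - + 1 ≡ ((-[1+ 0 ] - i) + j) - + 0
  e₁ = solve-∀

  e₂ : ∀ i j β → (β + + 1) - (j - i) ≡ β - ((-[1+ 0 ] - i) + j)
  e₂ = solve-∀

  e₃ : ∀ i j → (i + j) - + 0 ≡ (j - (-[1+ 0 ] - i)) - + 1
  e₃ = solve-∀

  e₄ : ∀ i j α → α - (i + j) ≡ (α + + 1) - (j - (-[1+ 0 ] - i))
  e₄ = solve-∀

-- The reflected tiling is given as a preimage. As the reflection is an involution, this is also the
-- image, and membership needs no existential.
reflect-partition : ∀ a b {T} → IsPartition (AztecRectangle a b) T →
                    IsPartition (AztecRectangle b a) (λ t → T (reflectTromino t))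
reflect-partition a b {T} P = record
  { inside   = λ {t} t∈ {c} c∈ →
      subst (AztecRectangle b a) (reflectCell-involutive c)
        (reflect-Aztec b a (reflectCell c) (inside t∈ (reflect-∈ t c∈)))
  ; covering = λ {c} c∈ → cover′ c (covering (reflect-Aztec a b c c∈))
  ; disjoint = λ {t} {u} t∈ u∈ c∈t c∈u →
      trans (sym (reflectTromino-involutive t))
        (trans (cong reflectTromino
                 (disjoint t∈ u∈ (reflect-∈ t c∈t) (reflect-∈ u c∈u)))
               (reflectTromino-involutive u))
  }
  where
  open IsPartition P

  cover′ : ∀ c → ∃[ t ] t ∈ T × reflectCell c ∈ ⟦ t ⟧ →
           ∃[ t ] T (reflectTromino t) × c ∈ ⟦ t ⟧
  cover′ c (t , t∈ , c∈) =
    reflectTromino t ,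
    subst T (sym (reflectTromino-involutive t)) t∈ ,
    subst ⟦ reflectTromino t ⟧ (reflectCell-involutive c) (reflect-∈ t c∈)

-- Partitions into right-oriented trominoes

module RightOriented
  (a b : ℕ) {T : Pred Tromino 0ℓ}
  (P : IsPartition (AztecRectangle a b) T) (T⊆right : T ⊆ Oriented right)
  where

  open IsPartition P

  R : Region
  R = AztecRectangle a b

  -- The position of a cell in its tile: the value of `s` exceeds that of the offset by 0 for
  -- `start`, 1 for `mid01` and `mid10`, 2 for `end`. The offset of `mid01` has `d` larger by one
  -- than the cell, that of `mid10` smaller by one.
  data CoveredBy (i j : ℤ) : Set where
    start : ∀ S → T (tromino S (i , j)) → CoveredBy i j
    mid01 : T (tromino no01 (i - + 1 , j)) → CoveredBy i j
    mid10 : T (tromino no10 (i , j - + 1)) → CoveredBy i j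
    end   : ∀ S → T (tromino S (i - + 1 , j - + 1)) → CoveredBy i j

  tile-cases : ∀ {t i j} → t ∈ T → (i , j) ∈ ⟦ t ⟧ → CoveredBy i j
  tile-cases {tromino S (x , y)} t∈ = go S t∈
    where
    +0 : ∀ x → x ≡ x + + 0
    +0 = solve-∀

    +1-1 : ∀ x → x ≡ x + + 1 - + 1
    +1-1 = solve-∀

    move : ∀ {S x′ y′} → x ≡ x′ → y ≡ y′ →
           T (tromino S (x , y)) → T (tromino S (x′ , y′))
    move refl refl t = t

    go : ∀ S {i j} → T (tromino S (x , y)) → (i , j) ∈ ⟦ tromino S (x , y) ⟧ →
         CoveredBy i j
    go no01 t (here refl)                 = start no01 (move (+0 x) (+0 y) t)
    go no01 t (there (here refl))         = mid01 (move (+1-1 x) (+0 y) t)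
    go no01 t (there (there (here refl))) = end no01 (move (+1-1 x) (+1-1 y) t)
    go no10 t (here refl)                 = start no10 (move (+0 x) (+0 y) t)
    go no10 t (there (here refl))         = mid10 (move (+0 x) (+1-1 y) t)
    go no10 t (there (there (here refl))) = end no10 (move (+1-1 x) (+1-1 y) t)
    go no00 t _ = contradiction (T⊆right t) λ ()
    go no11 t _ = contradiction (T⊆right t) λ ()

  covered : ∀ {i j} → R (i , j) → CoveredBy i j
  covered c∈ with t , t∈ , c∈t ← covering c∈ = tile-cases t∈ c∈t

  first∈ : ∀ S {x y} → T (tromino S (x , y)) → (x + + 0 , y + + 0) ∈ ⟦ tromino S (x , y) ⟧
  first∈ no01 t = here refl
  first∈ no10 t = here refl
  first∈ no00 t = contradiction (T⊆right t) λ ()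
  first∈ no11 t = here refl

  last∈ : ∀ S {x y} → T (tromino S (x , y)) → (x + + 1 , y + + 1) ∈ ⟦ tromino S (x , y) ⟧
  last∈ no01 t = there (there (here refl))
  last∈ no10 t = there (there (here refl))
  last∈ no00 t = there (there (here refl))
  last∈ no11 t = contradiction (T⊆right t) λ ()

  offset∈ : ∀ {S x y} → T (tromino S (x , y)) → R (x , y)
  offset∈ {S} {x} {y} t =
    subst R (cong₂ _,_ (+0 x) (+0 y)) (inside t (first∈ S t))
    where
    +0 : ∀ x → x + + 0 ≡ x
    +0 = solve-∀

  -- A right-oriented tile contains its offset cell, so that cell satisfies the bound `0 ≤ s` of the
  -- region.
  offset-bound : ∀ {S x y} → T (tromino S (x , y)) → ¬ (x + y ≤ -[1+ 0 ])
  offset-bound {S} {x} {y} t s≤-1 =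
    1≰0 (≤-by-difference (e (x + y)) (+-mono-≤ s≤-1 (proj₁ (proj₁ (offset∈ {S} t)))))
    where
    e : ∀ s → (-[1+ 0 ] + s) - (s + + 0) ≡ + 0 - + 1
    e = solve-∀

  covers-s=0 : ∀ {i j} → R (i , j) → i + j ≡ + 0 → ∃[ S ] T (tromino S (i , j))
  covers-s=0 {i} {j} c∈ s=0 with covered c∈
  ... | start S t = S , t
  ... | mid01 t = contradiction (≤-by-difference (e i j) (≤-reflexive s=0)) (offset-bound t)
    where
    e : ∀ i j → + 0 - (i + j) ≡ -[1+ 0 ] - (i - + 1 + j)
    e = solve-∀
  ... | mid10 t = contradiction (≤-by-difference (e i j) (≤-reflexive s=0)) (offset-bound t)
    where
    e : ∀ i j → + 0 - (i + j) ≡ -[1+ 0 ] - (i + (j - + 1))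
    e = solve-∀
  ... | end S t = contradiction (≤-by-difference (e i j) (+-mono-≤ (≤-reflexive s=0) -1≤0)) (offset-bound t)
    where
    -1≤0 : -[1+ 0 ] ≤ + 0
    -1≤0 = -≤+

    e : ∀ i j → (+ 0 + + 0) - (i + j + -[1+ 0 ]) ≡ -[1+ 0 ] - (i - + 1 + (j - + 1))
    e = solve-∀

  -- Going back by (1,1) keeps `d` and lowers `s` to 0, so it reaches a cell of the region that
  -- starts a tile. That tile ends at `(i , j)`, and by disjointness it is `t`.
  ends-s=2 : ∀ {t i j} → t ∈ T → (i , j) ∈ ⟦ t ⟧ → i + j ≡ + 2 →
             Tromino.offset t ≡ (i - + 1 , j - + 1)
  ends-s=2 {t} {i} {j} t∈ c∈t s=2 =
    let S , u∈ = covers-s=0 offset∈R s-2=0 in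
    cong Tromino.offset
      (disjoint t∈ u∈ c∈t
        (subst ⟦ tromino S (i - + 1 , j - + 1) ⟧ (cong₂ _,_ (-1+1 i) (-1+1 j)) (last∈ S u∈)))
    where
    e₁ : ∀ i j → i - + 1 + (j - + 1) ≡ i + j - + 2
    e₁ = solve-∀

    e₂ : ∀ i j → j - i ≡ j - + 1 - (i - + 1)
    e₂ = solve-∀

    -1+1 : ∀ x → x - + 1 + + 1 ≡ x
    -1+1 = solve-∀

    s-2=0 : i - + 1 + (j - + 1) ≡ + 0
    s-2=0 = trans (e₁ i j) (cong (_- + 2) s=2)

    offset∈R : R (i - + 1 , j - + 1)
    offset∈R with _ , (1≤d , d≤2a+1) ← inside t∈ c∈t =
      (≤-reflexive (sym s-2=0) , subst (_≤ _) (sym s-2=0) (+≤+ ℕ.z≤n)) ,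
      (subst (+ 1 ≤_) (e₂ i j) 1≤d , subst (_≤ _) (e₂ i j) d≤2a+1)

  covers-s=1 : ∀ {i j} → R (i , j) → i + j ≡ + 1 →
               T (tromino no01 (i - + 1 , j)) ⊎ T (tromino no10 (i , j - + 1))
  covers-s=1 {i} {j} c∈ s=1 with covered c∈
  -- A tile starting on `s = 1` has its middle cell on `s = 2`, where only last cells of tiles can
  -- lie. The offset would then differ from itself by one in a coordinate.
  ... | start no01 t =
    contradiction (≤-by-difference (e₂ j) (≤-reflexive
                    (cong proj₂ (ends-s=2 t (there (here refl)) (trans (e₁ i j) (cong (_+ + 1) s=1))))))
                  1≰0
    where
    e₁ : ∀ i j → i + + 1 + (j + + 0) ≡ i + j + + 1
    e₁ = solve-∀

    e₂ : ∀ j → (j + + 0 - + 1) - j ≡ + 0 - + 1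
    e₂ = solve-∀
  ... | start no10 t =
    contradiction (≤-by-difference (e₂ i) (≤-reflexive
                    (cong proj₁ (ends-s=2 t (there (here refl)) (trans (e₁ i j) (cong (_+ + 1) s=1))))))
                  1≰0
    where
    e₁ : ∀ i j → i + + 0 + (j + + 1) ≡ i + j + + 1
    e₁ = solve-∀

    e₂ : ∀ i → (i + + 0 - + 1) - i ≡ + 0 - + 1
    e₂ = solve-∀
  ... | start no00 t = contradiction (T⊆right t) λ ()
  ... | start no11 t = contradiction (T⊆right t) λ ()
  ... | mid01 t = inj₁ t
  ... | mid10 t = inj₂ t
  ... | end S t = contradiction (≤-by-difference (e i j) (≤-reflexive s=1)) (offset-bound t)
    where
    e : ∀ i j → + 1 - (i + j) ≡ -[1+ 0 ] - (i - + 1 + (j - + 1))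
    e = solve-∀

  diagonal : ∀ n → + 0 - n + (+ 1 + n) ≡ + 1
  diagonal = solve-∀

  -- These cells have `d = 2k + 1`, hence the range `k ≤ a`. Positivity of `b` gives `1 ≤ 2b`.
  s=1∈R : {{NonZero b}} → ∀ {k} → k ℕ.≤ a → R (+ 0 - + k , + 1 + + k)
  s=1∈R {{b≢0}} {k} k≤a =
    ( subst (+ 0 ≤_) (sym s=1) (+≤+ ℕ.z≤n)
    , subst (_≤ _) (sym s=1) (+≤+ (ℕ.≤-trans (ℕ.>-nonZero⁻¹ b {{b≢0}}) (ℕ.m≤m+n b _)))) ,
    ( ≤-by-difference (e₁ (+ k)) (+-mono-≤ (+≤+ (ℕ.z≤n {k})) (+≤+ (ℕ.z≤n {k})))
    , ≤-by-difference (e₂ (+ k) (+ a)) (+-mono-≤ (+≤+ k≤a) (+≤+ k≤a)))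
    where
    s=1 : + 0 - + k + (+ 1 + + k) ≡ + 1
    s=1 = diagonal (+ k)

    e₁ : ∀ n → (n + n) - (+ 0 + + 0) ≡ (+ 1 + n - (+ 0 - n)) - + 1
    e₁ = solve-∀

    e₂ : ∀ n α → (α + α) - (n + n) ≡ (α + (α + + 0) + + 1) - (+ 1 + n - (+ 0 - n))
    e₂ = solve-∀

  forced : {{NonZero b}} → ∀ k → k ℕ.≤ a → T (tromino no01 (+ 0 - + k - + 1 , + 1 + + k))
  forced k k≤a with covers-s=1 {+ 0 - + k} {+ 1 + + k} (s=1∈R k≤a) (diagonal (+ k))
  forced k       k≤a | inj₁ t = t
  -- The other candidate would start at (0,0), where `d = 0` is outside the region.
  forced zero    k≤a | inj₂ t = contradiction (proj₁ (proj₂ (offset∈ {no10} {+ 0} {+ 0} t))) 1≰0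
  -- The other candidate would start at the very cell where the tile forced for `k` starts, but with
  -- a different shape.
  forced (suc k) k≤a | inj₂ t =
    contradiction (cong Tromino.shape
      (disjoint (forced k (ℕ.≤-trans (ℕ.n≤1+n k) k≤a))
        (subst (λ p → T (tromino no10 p)) (cong₂ _,_ (e₁ (+ k)) (e₂ (+ k))) t)
        (here refl) (here refl))) λ ()
    where
    e₁ : ∀ n → + 0 - (+ 1 + n) ≡ + 0 - n - + 1
    e₁ = solve-∀

    e₂ : ∀ n → + 1 + (+ 1 + n) - + 1 ≡ + 1 + n
    e₂ = solve-∀

  impossible : ¬ NonZero b
  impossible b≢0 =
    1≰0 (≤-by-difference (e (+ a))
      -- The tile forced for `k = a` starts at `d = 2a + 2`, beyond the bound `2a + 1`.
      (proj₂ (proj₂ (offset∈ {no01} {+ 0 - + a - + 1} {+ 1 + + a} (forced {{b≢0}} a ℕ.≤-refl)))))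
    where
    e : ∀ α → (α + (α + + 0) + + 1) - (+ 1 + α - (+ 0 - α - + 1)) ≡ + 0 - + 1
    e = solve-∀

theorem5 : (a b : ℕ) → {{_ : NonZero a}} → {{_ : NonZero b}} → ¬ 180-Cover (AztecRectangle a b)
theorem5 a b {{a≢0}} {{b≢0}} cover with 180-Cover.oriented cover
... | inj₁ T⊆right =
  RightOriented.impossible a b (180-Cover.isPartition cover) T⊆right b≢0
-- Reflection swaps the two parameters, so positivity of `a` now takes the place of that of `b`.
... | inj₂ T⊆left =
  RightOriented.impossible b a (reflect-partition a b (180-Cover.isPartition cover))
    (λ {t} t∈ → reflectTromino-right t (T⊆left t∈)) a≢0
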